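{- For any graph $D$ on $n$ vertices (loops allowed) and any integer $q \ge 2$, $$\frac{1}{|\mathrm{F}[D,q]|} \sum_{f \in \mathrm{F}[D,q]} \mathrm{s}(f) \le \frac{n}{q}.$$
   Context: Graphs are finite and directed: $D=(V,E)$ with $V=\{1,\dots,n\}$, $n\ge1$, $E\subseteq V^2$. For an integer $q\ge2$ let $[q]=\{0,\dots,q-1\}$. For $f=(f_1,\dots,f_n):[q]^n\to[q]^n$, the interaction graph $G(f)$ has vertex set $V$ and an arc $(u,v)$ if and only if there exist $x,y\in[q]^n$ differing only in coordinate $u$ with $f_v(x)\ne f_v(y)$. $\mathrm{F}[D,q]$ is the set of all $f:[q]^n\to[q]^n$ with $G(f)=D$. With $d_{\mathrm H}$ the Hamming distance, $\mathrm{s}(f)=\min_{x\in[q]^n}(n-d_{\mathrm H}(x,f(x)))$. -}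

module Defs where

open import Data.Bool.Base using (if_then_else_)
open import Data.Fin.Base using (Fin; zero; suc; finToFun; funToFin)
open import Data.Fin.Properties as Fin
  using (any?; all?; finToFun-funToFin; funToFin-finToFin)
open import Data.Integer.Base using (+_)
open import Data.List.Base as List using (List; []; _∷_; length; filter)
open import Data.List.Extrema.Nat using (min)
open import Data.List.Membership.Propositional using (_∈_)
open import Data.List.Membership.Propositional.Properties
  using (∈-map⁺; ∈-allFin; ∈-filter⁺)
open import Data.Nat.ListAction using (sum)
open import Data.Nat.Base
  using (ℕ; 2+; _∸_; _^_; NonZero; NonTrivial)
open import Data.Product.Base using (_×_; _,_; ∃; ∃₂)
open import Data.Rational.Base using (ℚ; _/_)
open import Data.Vec.Base as Vec
  using (Vec; lookup; tabulate; count; replicate; _[_]≔_)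
open import Data.Vec.Properties
  using (tabulate∘lookup; lookup∘tabulate; tabulate-cong; lookup-replicate;
         lookup∘update; lookup∘update′)
open import Function.Base using (_∘_; _$_)
open import Level using (0ℓ)
open import Relation.Binary.Core using (Rel)
open import Relation.Binary.Definitions using (Decidable)
open import Relation.Binary.PropositionalEquality
  using (_≡_; _≢_; _≗_; refl; sym; trans; cong; subst; module ≡-Reasoning)
open import Relation.Nullary.Decidable
  using (Dec; yes; no; does; map′; ¬?; _×-dec_; _→-dec_; dec-true; dec-false)
open import Relation.Nullary.Negation using (¬_; contradiction)

private
  variable
    n q : ℕ

record Digraph (n : ℕ) : Set₁ where
  field
    Arc  : Rel (Fin n) 0ℓ
    Arc? : Decidable Arc

open Digraph public

infix 4 _≐_ _≐?_

-- The vertex set is fixed, so two graphs are equal when they have the same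
-- arcs.
_≐_ : Digraph n → Digraph n → Set
D ≐ D′ = ∀ u v → (Arc D u v → Arc D′ u v) × (Arc D′ u v → Arc D u v)

_≐?_ : (D D′ : Digraph n) → Dec (D ≐ D′)
D ≐? D′ = all? λ u → all? λ v →
  (Arc? D u v →-dec Arc? D′ u v) ×-dec (Arc? D′ u v →-dec Arc? D u v)

Config : (n q : ℕ) → Set
Config n q = Vec (Fin q) n

-- Maps are considered up to pointwise equality _≗_.
Map : (n q : ℕ) → Set
Map n q = Config n q → Config n q

encode : Config n q → Fin (q ^ n)
encode x = funToFin (lookup x)

decode : Fin (q ^ n) → Config n q
decode k = tabulate (finToFun k)

decode-encode : (x : Config n q) → decode (encode x) ≡ x
decode-encode x =
  trans (tabulate-cong (finToFun-funToFin (lookup x))) (tabulate∘lookup x)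

funToFin-cong : ∀ {m k} {f g : Fin m → Fin k} → f ≗ g → funToFin f ≡ funToFin g
funToFin-cong {ℕ.zero}  f≗g = refl
funToFin-cong {ℕ.suc m} f≗g
  rewrite f≗g zero | funToFin-cong (f≗g ∘ suc) = refl

encode-decode : (k : Fin (q ^ n)) → encode {n} {q} (decode k) ≡ k
encode-decode {q} {n} k =
  trans (funToFin-cong (lookup∘tabulate (finToFun {q} {n} k)))
        (funToFin-finToFin {n} {q} k)

allConfigs : (n q : ℕ) → List (Config n q)
allConfigs n q = List.map decode (List.allFin (q ^ n))

anyConfig? : {P : Config n q → Set} → (∀ x → Dec (P x)) → Dec (∃ P)
anyConfig? {P = P} P? = map′
  (λ (k , p) → decode k , p)
  (λ (x , p) → encode x , subst P (sym (decode-encode x)) p)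
  (any? (P? ∘ decode))

toMap : Fin ((q ^ n) ^ (q ^ n)) → Map n q
toMap {q} {n} k = decode ∘ finToFun {q ^ n} {q ^ n} k ∘ encode

fromMap : Map n q → Fin ((q ^ n) ^ (q ^ n))
fromMap {n} {q} f = funToFin {q ^ n} {q ^ n} (encode ∘ f ∘ decode)

allMaps : (n q : ℕ) → List (Map n q)
allMaps n q = List.map toMap (List.allFin ((q ^ n) ^ (q ^ n)))

-- With toMap-injective, this shows that every map occurs exactly once in
-- allMaps, up to pointwise equality.
toMap-fromMap : (f : Map n q) → toMap (fromMap f) ≗ f
toMap-fromMap {n} {q} f x = begin
  decode (finToFun (fromMap f) (encode x))
    ≡⟨ cong decode (finToFun-funToFin (encode ∘ f ∘ decode) (encode x)) ⟩
  decode (encode (f (decode (encode x))))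
    ≡⟨ decode-encode _ ⟩
  f (decode (encode x))
    ≡⟨ cong f (decode-encode x) ⟩
  f x ∎
  where open ≡-Reasoning

toMap-injective : (j k : Fin ((q ^ n) ^ (q ^ n))) →
                  toMap {q} {n} j ≗ toMap k → j ≡ k
toMap-injective {q} {n} j k eq =
  trans (sym (funToFin-finToFin {N} {N} j))
    (trans (funToFin-cong {N} {N} same) (funToFin-finToFin {N} {N} k))
  where
  N = q ^ n

  same : finToFun {N} {N} j ≗ finToFun k
  same i = begin
    finToFun j i
      ≡⟨ encode-decode {q} {n} _ ⟨
    encode {n} {q} (decode (finToFun j i))
      ≡⟨ cong (λ i → encode {n} {q} (decode (finToFun {N} {N} j i)))
           (encode-decode {q} {n} i) ⟨
    encode {n} {q} (toMap j (decode i))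
      ≡⟨ cong encode (eq (decode i)) ⟩
    encode {n} {q} (toMap k (decode i))
      ≡⟨ cong (λ i → encode {n} {q} (decode (finToFun {N} {N} k i)))
           (encode-decode {q} {n} i) ⟩
    encode {n} {q} (decode (finToFun k i))
      ≡⟨ encode-decode {q} {n} _ ⟩
    finToFun k i ∎
    where open ≡-Reasoning

DifferOnlyIn : Fin n → Config n q → Config n q → Set
DifferOnlyIn u x y =
  lookup x u ≢ lookup y u × (∀ w → w ≢ u → lookup x w ≡ lookup y w)

differOnlyIn? : (u : Fin n) (x y : Config n q) → Dec (DifferOnlyIn u x y)
differOnlyIn? u x y =
  ¬? (lookup x u Fin.≟ lookup y u) ×-dec
  all? λ w → ¬? (w Fin.≟ u) →-dec (lookup x w Fin.≟ lookup y w)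

interactionGraph : Map n q → Digraph n
interactionGraph f .Arc u v = ∃₂ λ x y →
  DifferOnlyIn u x y × lookup (f x) v ≢ lookup (f y) v
interactionGraph f .Arc? u v = anyConfig? λ x → anyConfig? λ y →
  differOnlyIn? u x y ×-dec ¬? (lookup (f x) v Fin.≟ lookup (f y) v)

F[_,_] : Digraph n → (q : ℕ) → List (Map n q)
F[_,_] {n} D q = filter (λ f → interactionGraph f ≐? D) (allMaps n q)

hamming : Config n q → Config n q → ℕ
hamming x y =
  count (λ i → ¬? (lookup x i Fin.≟ lookup y i)) (Vec.allFin _)

-- The first argument of min is only a default value: n bounds every
-- n ∸ hamming x (f x), so for q ≥ 1, where allConfigs is non-empty, it does
-- not affect the minimum.
s : Map n q → ℕ
s {n} {q} f = min n (List.map (λ x → n ∸ hamming x (f x)) (allConfigs n q))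

mean : {A : Set} (g : A → ℕ) (xs : List A) .{{_ : NonZero (length xs)}} → ℚ
mean g xs = + sum (List.map g xs) / length xs

-- The conjunction network: component v is 1 when all in-neighbours of v are
-- nonzero, and 0 otherwise. Its interaction graph is D.
private
  module Conjunction (D : Digraph n) (r : ℕ) where

    Q : ℕ
    Q = 2+ r

    𝟘 𝟙 : Fin Q
    𝟘 = zero
    𝟙 = suc zero

    Holds : Config n Q → Fin n → Set
    Holds x v = ∀ u → Arc D u v → lookup x u ≢ 𝟘

    holds? : ∀ x v → Dec (Holds x v)
    holds? x v = all? λ u → Arc? D u v →-dec ¬? (lookup x u Fin.≟ 𝟘)

    component : Config n Q → Fin n → Fin Q
    component x v = if does (holds? x v) then 𝟙 else 𝟘

    conj : Map n Q
    conj x = tabulate (component x)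

    holds⇒𝟙 : ∀ x v → Holds x v → lookup (conj x) v ≡ 𝟙
    holds⇒𝟙 x v h
      rewrite lookup∘tabulate (component x) v | dec-true (holds? x v) h = refl

    ¬holds⇒𝟘 : ∀ x v → ¬ Holds x v → lookup (conj x) v ≡ 𝟘
    ¬holds⇒𝟘 x v ¬h
      rewrite lookup∘tabulate (component x) v | dec-false (holds? x v) ¬h = refl

    arc⁻ : ∀ u v → Arc (interactionGraph conj) u v → Arc D u v
    arc⁻ u v (x , y , (_ , same) , fx≢fy) with Arc? D u v
    ... | yes a = a
    ... | no ¬a = contradiction fx≡fy fx≢fy
      where
      agree : ∀ w → Arc D w v → lookup x w ≡ lookup y w
      agree w a = same w λ { refl → ¬a a }

      fx≡fy : lookup (conj x) v ≡ lookup (conj y) v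
      fx≡fy with holds? x v
      ... | yes h = trans (holds⇒𝟙 x v h)
        (sym (holds⇒𝟙 y v λ w a → h w a ∘ trans (agree w a)))
      ... | no ¬h = trans (¬holds⇒𝟘 x v ¬h)
        (sym (¬holds⇒𝟘 y v λ h → ¬h λ w a → h w a ∘ trans (sym (agree w a))))

    arc⁺ : ∀ u v → Arc D u v → Arc (interactionGraph conj) u v
    arc⁺ u v a = ones , dent , (differ , same) , fx≢fy
      where
      ones dent : Config n Q
      ones = replicate n 𝟙
      dent = ones [ u ]≔ 𝟘

      one : ∀ w → lookup ones w ≢ 𝟘
      one w eq with () ← trans (sym (lookup-replicate w 𝟙)) eq

      differ : lookup ones u ≢ lookup dent u
      differ eq = one u (trans eq (lookup∘update u ones 𝟘))

      same : ∀ w → w ≢ u → lookup ones w ≡ lookup dent w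
      same w w≢u = sym (lookup∘update′ w≢u ones 𝟘)

      fx≢fy : lookup (conj ones) v ≢ lookup (conj dent) v
      fx≢fy eq with () ←
        trans (sym (holds⇒𝟙 ones v λ w _ → one w))
          (trans eq (¬holds⇒𝟘 dent v λ h → h u a (lookup∘update u ones 𝟘)))

  interactionGraph-cong : {f g : Map n q} → f ≗ g → ∀ u v →
    Arc (interactionGraph f) u v → Arc (interactionGraph g) u v
  interactionGraph-cong f≗g u v (x , y , d , fx≢fy) =
    x , y , d , λ eq → fx≢fy $
      trans (cong (λ z → lookup z v) (f≗g x))
        (trans eq (cong (λ z → lookup z v) (sym (f≗g y))))

  ∈⇒nonZero : {A : Set} {x : A} {xs : List A} → x ∈ xs → NonZero (length xs)
  ∈⇒nonZero {xs = _ ∷ _} _ = _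

F-nonEmpty : (D : Digraph n) (q : ℕ) .{{_ : NonTrivial q}} →
             NonZero (length F[ D , q ])
F-nonEmpty D (2+ r) = ∈⇒nonZero $
  ∈-filter⁺ (λ f → interactionGraph f ≐? D)
    (∈-map⁺ toMap (∈-allFin (fromMap conj)))
    λ u v → arc⁻ u v ∘ interactionGraph-cong (toMap-fromMap conj) u v
          , interactionGraph-cong (sym ∘ toMap-fromMap conj) u v ∘ arc⁺ u v
  where open Conjunction D r

{-# OPTIONS --safe #-}
module Submission where

-- For c ∈ ℤ/q the reflection b ↦ c − b is a bijection of [q], so composing with
-- it in every coordinate preserves the interaction graph and permutes F[ D , q ].
-- For fixed x and f, coordinate i satisfies xᵢ = c − fᵢ(x) for exactly one c;
-- hence the q reflections of f have at x at most n agreements in total, and the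
-- sum of their values of s is at most n. Averaging over F[ D , q ] gives n / q.
-- Reflections are used rather than translations because they are involutions.

open import Defs
open import Data.Bool.Base using (true; false; if_then_else_)
open import Data.Fin.Base using (Fin; zero; suc; toℕ; fromℕ<)
open import Data.Fin.Permutation using (Permutation′; permutation)
open import Data.Fin.Properties as Fin
  using (toℕ<n; toℕ≤n; toℕ-injective; toℕ-fromℕ<)
open import Data.Integer.Base as ℤ using (+_)
open import Data.Integer.Properties using (pos-*)
open import Data.List.Base as List using (List; []; _∷_; filter; length)
open import Data.List.Extrema.Nat using (min≤xs)
open import Data.List.Membership.Propositional using (_∈_)
open import Data.List.Membership.Propositional.Properties using (∈-map⁺; ∈-allFin)
open import Data.List.Properties using (map-tabulate)
import Data.List.Relation.Unary.All as All
open import Data.Nat.Base as ℕ hiding (_/_; _≤_)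
open import Data.Nat.DivMod hiding (_/_)
open import Data.Nat.ListAction using () renaming (sum to sumᴸ)
open import Data.Nat.Properties
open import Data.Product.Base using (_,_)
open import Data.Rational.Base as ℚ using (_/_; _≤_)
open import Data.Rational.Properties using (toℚᵘ-cancel-≤; toℚᵘ-fromℚᵘ)
open import Data.Rational.Unnormalised.Base using (mkℚᵘ; *≤*)
import Data.Rational.Unnormalised.Properties as ℚᵘ
open import Data.Vec.Base as Vec using (count; lookup; replicate)
open import Data.Vec.Properties using (lookup-map; map-∘; map-cong; map-id)
open import Function.Base using (_∘_; const)
open import Function.Bundles using (mk⇔)
open import Function.Definitions using (Injective)
open import Relation.Binary.PropositionalEquality
open import Relation.Nullary.Decidable using (Dec; does; yes; no; ¬?; does-⇔)
open import Relation.Unary using (Decidable)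

open import Algebra.Properties.CommutativeMonoid.Sum +-0-commutativeMonoid
  using (sum; sum-syntax; sum-cong-≗; ∑-comm; ∑-permute)

private
  variable
    n q : ℕ

-- Finite sums and counting.

sum-mono-≤ : {f g : Fin n → ℕ} → (∀ i → f i ℕ.≤ g i) → sum f ℕ.≤ sum g
sum-mono-≤ {zero}  f≤g = z≤n
sum-mono-≤ {suc n} f≤g = +-mono-≤ (f≤g zero) (sum-mono-≤ (f≤g ∘ suc))

sum-const : ∀ n c → ∑[ i < n ] c ≡ n * c
sum-const zero    c = refl
sum-const (suc n) c = cong₂ _+_ refl (sum-const n c)

⟦_⟧ : {P : Set} → Dec P → ℕ
⟦ P? ⟧ = if does P? then 1 else 0

sum-⟦⟧-≤1 : {P : Fin n → Set} (P? : Decidable P) →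
            (∀ {i j} → P i → P j → i ≡ j) → ∑[ i < n ] ⟦ P? i ⟧ ℕ.≤ 1
sum-⟦⟧-≤1 {zero}  P? unique = z≤n
sum-⟦⟧-≤1 {suc n} P? unique with P? zero
... | no  _  = sum-⟦⟧-≤1 (P? ∘ suc) λ p p′ → Fin.suc-injective (unique p p′)
... | yes p₀ = ≤-reflexive (cong suc
  (trans (sum-cong-≗ vanish) (trans (sum-const n 0) (*-zeroʳ n))))
  where
  vanish : ∀ i → ⟦ P? (suc i) ⟧ ≡ 0
  vanish i with P? (suc i)
  ... | no  _ = refl
  ... | yes p with () ← unique p₀ p

-- Each index contributes exactly 1, either to the count or to the sum. The additive form avoids
-- truncated subtraction in the induction.
count-¬+sum : {A : Set} {P : A → Set} (P? : Decidable P) (f : Fin n → A) →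
              count (¬? ∘ P?) (Vec.tabulate f) + ∑[ i < n ] ⟦ P? (f i) ⟧ ≡ n
count-¬+sum {zero}  P? f = refl
count-¬+sum {suc n} P? f with P? (f zero)
... | yes _ = trans (+-suc _ _) (cong suc (count-¬+sum P? (f ∘ suc)))
... | no  _ = cong suc (count-¬+sum P? (f ∘ suc))

-- Trades the filter for zero terms, so that the sum runs over all of `Fin n` and can be reindexed
-- by a permutation.
sum-filter-tabulate :
  {A : Set} {P : A → Set} (P? : Decidable P) (g : A → ℕ) (h : Fin n → A) →
  sumᴸ (List.map g (filter P? (List.tabulate h))) ≡
  ∑[ k < n ] (if does (P? (h k)) then g (h k) else 0)
sum-filter-tabulate {zero}  P? g h = refl
sum-filter-tabulate {suc n} P? g h with does (P? (h zero))
... | false = sum-filter-tabulate P? g (h ∘ suc)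
... | true  = cong₂ _+_ refl (sum-filter-tabulate P? g (h ∘ suc))

sum-map-const : {A : Set} (c : ℕ) (xs : List A) →
                sumᴸ (List.map (const c) xs) ≡ length xs * c
sum-map-const c []       = refl
sum-map-const c (x ∷ xs) = cong₂ _+_ refl (sum-map-const c xs)

-- Modular arithmetic on `Fin q`.

%-absorbˡ-+ : ∀ m n d .{{_ : NonZero d}} → (m % d + n) % d ≡ (m + n) % d
%-absorbˡ-+ m n d = begin
  (m % d + n) % d          ≡⟨ %-distribˡ-+ (m % d) n d ⟩
  (m % d % d + n % d) % d  ≡⟨ cong (λ k → (k + n % d) % d) (m%n%n≡m%n m d) ⟩
  (m % d + n % d) % d      ≡⟨ %-distribˡ-+ m n d ⟨
  (m + n) % d              ∎
  where open ≡-Reasoning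

module _ .{{_ : NonZero q}} where

  infixl 6 _⊕_ _⊖_

  residue : ℕ → Fin q
  residue m = fromℕ< (m%n<n m q)

  _⊕_ _⊖_ : Fin q → Fin q → Fin q
  a ⊕ b = residue (toℕ a + toℕ b)
  a ⊖ b = residue (toℕ a + (q ∸ toℕ b))

  -- Two successive shifts add up to a shift by `q`, which vanishes modulo `q`. Taking `toℕ b` and
  -- `q ∸ toℕ b` as the shifts, in either order, gives both cancellation laws.
  residue-residue-+ : ∀ (a : Fin q) m n → m + n ≡ q →
                      residue (toℕ (residue (toℕ a + m)) + n) ≡ a
  residue-residue-+ a m n m+n≡q = toℕ-injective (begin
    toℕ (residue (toℕ (residue (toℕ a + m)) + n))
      ≡⟨ toℕ-fromℕ< _ ⟩
    (toℕ (residue (toℕ a + m)) + n) % q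
      ≡⟨ cong (λ k → (k + n) % q) (toℕ-fromℕ< (m%n<n (toℕ a + m) q)) ⟩
    ((toℕ a + m) % q + n) % q
      ≡⟨ %-absorbˡ-+ (toℕ a + m) n q ⟩
    (toℕ a + m + n) % q
      ≡⟨ cong (_% q) (trans (+-assoc (toℕ a) m n) (cong₂ _+_ refl m+n≡q)) ⟩
    (toℕ a + q) % q
      ≡⟨ [m+n]%n≡m%n (toℕ a) q ⟩
    toℕ a % q
      ≡⟨ m<n⇒m%n≡m (toℕ<n a) ⟩
    toℕ a ∎)
    where open ≡-Reasoning

  ⊖-⊕ : ∀ a b → a ⊖ b ⊕ b ≡ a
  ⊖-⊕ a b = residue-residue-+ a (q ∸ toℕ b) (toℕ b) (m∸n+n≡m (toℕ≤n b))

  ⊕-⊖ : ∀ a b → a ⊕ b ⊖ b ≡ a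
  ⊕-⊖ a b = residue-residue-+ a (toℕ b) (q ∸ toℕ b) (m+[n∸m]≡n (toℕ≤n b))

  ⊕-comm : ∀ a b → a ⊕ b ≡ b ⊕ a
  ⊕-comm a b = cong residue (+-comm (toℕ a) (toℕ b))

  -- Writing `c` as `b ⊕ (c ⊖ b)` lets `c ⊖ b` be cancelled.
  ⊖-involutive : ∀ c b → c ⊖ (c ⊖ b) ≡ b
  ⊖-involutive c b = begin
    c ⊖ (c ⊖ b)                ≡⟨ cong (_⊖ (c ⊖ b)) (⊖-⊕ c b) ⟨
    c ⊖ b ⊕ b ⊖ (c ⊖ b)        ≡⟨ cong (_⊖ (c ⊖ b)) (⊕-comm (c ⊖ b) b) ⟩
    b ⊕ (c ⊖ b) ⊖ (c ⊖ b)      ≡⟨ ⊕-⊖ b (c ⊖ b) ⟩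
    b                          ∎
    where open ≡-Reasoning

  ⊖-injectiveʳ : ∀ c → Injective _≡_ _≡_ (c ⊖_)
  ⊖-injectiveʳ c {a} {b} eq =
    trans (sym (⊖-involutive c a)) (trans (cong (c ⊖_) eq) (⊖-involutive c b))

  ⊖-injectiveˡ : ∀ b → Injective _≡_ _≡_ (_⊖ b)
  ⊖-injectiveˡ b {c} {d} eq = trans (sym (⊖-⊕ c b)) (trans (cong (_⊕ b) eq) (⊖-⊕ d b))

-- Agreements, and interaction graphs under relabelling.

agreements : Config n q → Config n q → ℕ
agreements {n} x y = ∑[ i < n ] ⟦ lookup x i Fin.≟ lookup y i ⟧

n∸hamming : (x y : Config n q) → n ∸ hamming x y ≡ agreements x y
n∸hamming {n} x y =
  trans (cong (_∸ hamming x y)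
          (sym (count-¬+sum (λ i → lookup x i Fin.≟ lookup y i) (λ i → i))))
        (m+n∸m≡n (hamming x y) (agreements x y))

∈-allConfigs : (x : Config n q) → x ∈ allConfigs n q
∈-allConfigs {n} {q} x =
  subst (_∈ allConfigs n q) (decode-encode x) (∈-map⁺ decode (∈-allFin (encode x)))

s≤agreements : (f : Map n q) (x : Config n q) → s f ℕ.≤ agreements x (f x)
s≤agreements {n} {q} f x = subst (s f ℕ.≤_) (n∸hamming x (f x))
  (All.lookup (min≤xs n (List.map value (allConfigs n q))) (∈-map⁺ value (∈-allConfigs x)))
  where
  value : Config n q → ℕ
  value x = n ∸ hamming x (f x)

-- The same pair `x`, `y` witnesses the arc, since an injective `τ` keeps distinct component values
-- distinct.
interactionGraph-relabel :
  {f g : Map n q} {τ : Fin q → Fin q} → Injective _≡_ _≡_ τ →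
  (∀ x → g x ≡ Vec.map τ (f x)) →
  ∀ u v → Arc (interactionGraph f) u v → Arc (interactionGraph g) u v
interactionGraph-relabel {f = f} {g} {τ} τ-injective g≡τf u v (x , y , differ , fx≢fy) =
  x , y , differ , λ gx≡gy → fx≢fy (τ-injective (begin
    τ (lookup (f x) v)  ≡⟨ at x ⟨
    lookup (g x) v      ≡⟨ gx≡gy ⟩
    lookup (g y) v      ≡⟨ at y ⟩
    τ (lookup (f y) v)  ∎))
  where
  open ≡-Reasoning

  at : ∀ z → lookup (g z) v ≡ τ (lookup (f z) v)
  at z = trans (cong (λ w → lookup w v) (g≡τf z)) (lookup-map v τ (f z))

-- Reflections acting on maps.

module Reflection (n q : ℕ) .{{_ : NonZero q}} where

  Code : Set
  Code = Fin ((q ^ n) ^ (q ^ n))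

  ⟨_⟩ : Code → Map n q
  ⟨_⟩ = toMap

  -- Acting on codes makes the involution hold up to `_≡_`, hence gives a genuine permutation; on
  -- maps it would hold only pointwise.
  reflect : Fin q → Code → Code
  reflect c k = fromMap (Vec.map (c ⊖_) ∘ ⟨ k ⟩)

  ⟨reflect⟩ : ∀ c k x → ⟨ reflect c k ⟩ x ≡ Vec.map (c ⊖_) (⟨ k ⟩ x)
  ⟨reflect⟩ c k = toMap-fromMap (Vec.map (c ⊖_) ∘ ⟨ k ⟩)

  ⟨reflect⟩⁻¹ : ∀ c k x → ⟨ k ⟩ x ≡ Vec.map (c ⊖_) (⟨ reflect c k ⟩ x)
  ⟨reflect⟩⁻¹ c k x = sym (begin
    Vec.map (c ⊖_) (⟨ reflect c k ⟩ x)         ≡⟨ cong (Vec.map (c ⊖_)) (⟨reflect⟩ c k x) ⟩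
    Vec.map (c ⊖_) (Vec.map (c ⊖_) (⟨ k ⟩ x))  ≡⟨ map-∘ (c ⊖_) (c ⊖_) _ ⟨
    Vec.map (λ b → c ⊖ (c ⊖ b)) (⟨ k ⟩ x)      ≡⟨ map-cong (⊖-involutive c) _ ⟩
    Vec.map (λ b → b) (⟨ k ⟩ x)                ≡⟨ map-id _ ⟩
    ⟨ k ⟩ x                                    ∎)
    where
    open ≡-Reasoning

  reflect-involutive : ∀ c k → reflect c (reflect c k) ≡ k
  reflect-involutive c k = toMap-injective {q} {n} _ _ λ x →
    trans (⟨reflect⟩ c (reflect c k) x) (sym (⟨reflect⟩⁻¹ c k x))

  reflection : Fin q → Permutation′ ((q ^ n) ^ (q ^ n))
  reflection c =
    permutation (reflect c) (reflect c) (reflect-involutive c) (reflect-involutive c)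

  -- Double counting: after exchanging the sums, each coordinate agrees for at most one `c`, because
  -- `_⊖ b` is injective.
  agreements-reflect : (x y : Config n q) →
    ∑[ c < q ] agreements x (Vec.map (c ⊖_) y) ℕ.≤ n
  agreements-reflect x y = begin
    ∑[ c < q ] ∑[ i < n ] ⟦ lookup x i Fin.≟ lookup (Vec.map (c ⊖_) y) i ⟧
      ≡⟨ ∑-comm (λ c i → ⟦ lookup x i Fin.≟ lookup (Vec.map (c ⊖_) y) i ⟧) ⟩
    ∑[ i < n ] ∑[ c < q ] ⟦ lookup x i Fin.≟ lookup (Vec.map (c ⊖_) y) i ⟧
      ≤⟨ sum-mono-≤ (λ i → sum-⟦⟧-≤1
           (λ c → lookup x i Fin.≟ lookup (Vec.map (c ⊖_) y) i) (unique i)) ⟩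
    ∑[ i < n ] 1
      ≡⟨ sum-const n 1 ⟩
    n * 1
      ≡⟨ *-identityʳ n ⟩
    n ∎
    where
    open ≤-Reasoning

    unique : ∀ i {c d} → lookup x i ≡ lookup (Vec.map (c ⊖_) y) i →
             lookup x i ≡ lookup (Vec.map (d ⊖_) y) i → c ≡ d
    unique i {c} {d} eqᶜ eqᵈ = ⊖-injectiveˡ (lookup y i)
      (trans (sym (lookup-map i (c ⊖_) y))
        (trans (sym eqᶜ) (trans eqᵈ (lookup-map i (d ⊖_) y))))

  s-reflect : ∀ k → ∑[ c < q ] s ⟨ reflect c k ⟩ ℕ.≤ n
  s-reflect k = ≤-trans (sum-mono-≤ bound) (agreements-reflect x (⟨ k ⟩ x))
    where
    -- Any configuration serves here, as long as it is the same for every `c`.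
    x : Config n q
    x = replicate n (residue 0)

    bound : ∀ c → s ⟨ reflect c k ⟩ ℕ.≤ agreements x (Vec.map (c ⊖_) (⟨ k ⟩ x))
    bound c = subst (λ y → s ⟨ reflect c k ⟩ ℕ.≤ agreements x y) (⟨reflect⟩ c k x)
      (s≤agreements ⟨ reflect c k ⟩ x)

  -- Averaging over `F[ D , q ]`.

  module _ (D : Digraph n) where

    graph? : Decidable (λ (f : Map n q) → interactionGraph f ≐ D)
    graph? f = interactionGraph f ≐? D

    restrict : (Map n q → ℕ) → Code → ℕ
    restrict g k = if does (graph? ⟨ k ⟩) then g ⟨ k ⟩ else 0

    sum-F : ∀ g → sumᴸ (List.map g F[ D , q ]) ≡ sum (restrict g)
    sum-F g = trans
      (cong (sumᴸ ∘ List.map g ∘ filter graph?) (map-tabulate (λ k → k) ⟨_⟩))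
      (sum-filter-tabulate graph? g ⟨_⟩)

    -- The hypotheses are symmetric in `j` and `k`, as a reflection is its own inverse; one lemma
    -- thus yields both directions of the equivalence below.
    ≐D-reflect : ∀ c j k → (∀ x → ⟨ k ⟩ x ≡ Vec.map (c ⊖_) (⟨ j ⟩ x)) →
                 (∀ x → ⟨ j ⟩ x ≡ Vec.map (c ⊖_) (⟨ k ⟩ x)) →
                 interactionGraph ⟨ j ⟩ ≐ D → interactionGraph ⟨ k ⟩ ≐ D
    ≐D-reflect c j k k≡τj j≡τk Gⱼ≐D u v with Gⱼ≐D u v
    ... | to , from = to ∘ interactionGraph-relabel (⊖-injectiveʳ c) j≡τk u v
                    , interactionGraph-relabel (⊖-injectiveʳ c) k≡τj u v ∘ from

    does-graph?-reflect : ∀ c k → does (graph? ⟨ reflect c k ⟩) ≡ does (graph? ⟨ k ⟩)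
    does-graph?-reflect c k = does-⇔
      (mk⇔ (≐D-reflect c (reflect c k) k (⟨reflect⟩⁻¹ c k) (⟨reflect⟩ c k))
           (≐D-reflect c k (reflect c k) (⟨reflect⟩ c k) (⟨reflect⟩⁻¹ c k)))
      (graph? ⟨ reflect c k ⟩) (graph? ⟨ k ⟩)

    restrict-s-reflect : ∀ k → ∑[ c < q ] restrict s (reflect c k) ℕ.≤ restrict (const n) k
    restrict-s-reflect k = subst (ℕ._≤ restrict (const n) k)
      -- All reflections of `k` pass or fail the graph test together with `k`, so a single case
      -- split on `k` settles the whole sum.
      (sum-cong-≗ {q} λ c →
        cong (λ b → if b then s ⟨ reflect c k ⟩ else 0) (sym (does-graph?-reflect c k)))
      bound
      where
      bound : ∑[ c < q ] (if does (graph? ⟨ k ⟩) then s ⟨ reflect c k ⟩ else 0)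
              ℕ.≤ restrict (const n) k
      bound with does (graph? ⟨ k ⟩)
      ... | true  = s-reflect k
      ... | false = ≤-reflexive (trans (sum-const q 0) (*-zeroʳ q))

    q*sum-s≤ : q * sumᴸ (List.map s F[ D , q ]) ℕ.≤ length F[ D , q ] * n
    q*sum-s≤ = begin
      q * sumᴸ (List.map s F[ D , q ])
        ≡⟨ cong (q *_) (sum-F s) ⟩
      q * sum (restrict s)
        ≡⟨ sum-const q _ ⟨
      ∑[ c < q ] sum (restrict s)
        -- The `c`-th of the `q` copies is reindexed by the `c`-th reflection.
        ≡⟨ sum-cong-≗ {q} (λ c → ∑-permute (restrict s) (reflection c)) ⟩
      ∑[ c < q ] ∑[ k < (q ^ n) ^ (q ^ n) ] restrict s (reflect c k)
        ≡⟨ ∑-comm (λ c k → restrict s (reflect c k)) ⟩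
      ∑[ k < (q ^ n) ^ (q ^ n) ] ∑[ c < q ] restrict s (reflect c k)
        ≤⟨ sum-mono-≤ restrict-s-reflect ⟩
      -- Weight `n` on each member of `F[ D , q ]` and 0 elsewhere: the total is `n` times the
      -- cardinality.
      sum (restrict (const n))
        ≡⟨ sum-F (const n) ⟨
      sumᴸ (List.map (const n) F[ D , q ])
        ≡⟨ sum-map-const n F[ D , q ] ⟩
      length F[ D , q ] * n ∎
      where open ≤-Reasoning

-- From natural numbers to rationals.

/-mono-cross : ∀ a b c d .{{_ : NonZero b}} .{{_ : NonZero d}} →
               d * a ℕ.≤ b * c → (+ a / b) ≤ (+ c / d)
-- `_/_` reduces to lowest terms, so the comparison is made between unnormalised fractions, where it
-- is plain cross-multiplication.
/-mono-cross a (suc b) c (suc d) da≤bc = toℚᵘ-cancel-≤ (begin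
  ℚ.toℚᵘ (+ a / suc b)  ≃⟨ toℚᵘ-fromℚᵘ (mkℚᵘ (+ a) b) ⟩
  mkℚᵘ (+ a) b          ≤⟨ *≤* cross ⟩
  mkℚᵘ (+ c) d          ≃⟨ toℚᵘ-fromℚᵘ (mkℚᵘ (+ c) d) ⟨
  ℚ.toℚᵘ (+ c / suc d)  ∎)
  where
  open ℚᵘ.≤-Reasoning

  cross : + a ℤ.* + suc d ℤ.≤ + c ℤ.* + suc b
  cross = subst₂ ℤ._≤_
    (trans (cong +_ (*-comm (suc d) a)) (pos-* a (suc d)))
    (trans (cong +_ (*-comm (suc b) c)) (pos-* c (suc b)))
    (ℤ.+≤+ da≤bc)

proposition4p1 : (n : ℕ) .{{_ : NonZero n}} (D : Digraph n) (q : ℕ) .{{_ : NonTrivial q}} →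
    mean s F[ D , q ] {{F-nonEmpty D q}} ≤ (+ n / q) {{nonTrivial⇒nonZero q}}
proposition4p1 n D q =
  /-mono-cross _ (length F[ D , q ]) n q {{F-nonEmpty D q}} {{nonTrivial⇒nonZero q}}
    (Reflection.q*sum-s≤ n q {{nonTrivial⇒nonZero q}} D)
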